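{- Let $m\ge2$. For each ordered pair $(i,j)\in\{0,\dots,m-1\}^2$ and $n\ge2$ let $N_n^{i,j}$ be the number of pairs (full bracketing of $p_1\Rightarrow_G\cdots\Rightarrow_G p_n$, valuation $\nu:\{p_1,\dots,p_n\}\to V_m$) such that, writing the bracketing at its root as $\varphi\Rightarrow_G\psi$, one has $\nu(\varphi)=v_i$ and $\nu(\psi)=v_j$; set $N_1^{i,j}:=0$. Then: (i) There are exactly $m^2$ refined pair-sequences $\{N_n^{i,j}\}_{n\ge1}$, one for each ordered pair $(i,j)$. (ii) For all $(i,j)$, $N^{i,j}(x):=\sum_{n\ge1}N_n^{i,j}x^n=G_i(x)\,G_j(x)$, and in particular $N_1^{i,j}=0$. (iii) $v_i\Rightarrow_G v_j=v_{m-1}=1$ if $i\le j$ and $v_i\Rightarrow_G v_j=v_j$ if $i>j$. Hence $\frac{m(m+1)}2$ of the pair-sequences (those with $i\le j$) contribute to the top output value $v_{m-1}$, while for each $j\le m-2$ exactly $m-1-j$ pair-sequences (those with right index $j$ and $i>j$) contribute to the output value $v_j$.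
   Context: For an integer $m\ge2$ let $V_m=\{v_0<v_1<\cdots<v_{m-1}\}$ ($v_0=0$, $v_{m-1}=1$) be an $m$-element chain with Gödel implication $v_p\Rightarrow_G v_q=v_{m-1}$ if $p\le q$ and $v_p\Rightarrow_G v_q=v_q$ if $p>q$. For $n\ge1$, the full bracketings of $p_1\Rightarrow_G\cdots\Rightarrow_G p_n$ in $n$ distinct variables correspond to full binary trees with $n$ ordered leaves. For $n\ge2$ each bracketing is uniquely of the form $\varphi\Rightarrow_G\psi$ (root split), and $\nu(\varphi)$ denotes the value of subformula $\varphi$ under $\nu$. Let $g_n^{(k)}$ be the number of pairs (bracketing, valuation $\{p_1,\dots,p_n\}\to V_m$) for which the formula evaluates to $v_k$, and $G_k(x)=\sum_{n\ge1}g_n^{(k)}x^n$. Pair-sequences are counted as a family indexed by ordered pairs $(i,j)$ (not up to equality of sequences). A pair-sequence $(i,j)$ "contributes to output value $v_k$" if $v_i\Rightarrow_G v_j=v_k$. -}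

module Defs where

open import Axiom.UniquenessOfIdentityProofs using (module Decidable⇒UIP)
open import Data.Bool using (if_then_else_)
open import Data.Empty using (⊥)
open import Data.Fin using (Fin; zero; suc; fromℕ<)
open import Data.Fin.Properties using (+↔⊎; _≤?_; _≟_)
open import Data.List using (applyUpTo)
open import Data.Nat using (ℕ; zero; suc; pred; _+_; _*_; _∸_; _≤_; _<_; z≤n; s≤s; NonTrivial; nonTrivial⇒nonZero)
open import Data.Nat.ListAction using (sum)
import Data.Nat.Properties as ℕ
open import Data.Nat.Induction using (<-rec)
open import Data.Product using (Σ; ∃; _×_; _,_; proj₁)
open import Data.Product.Function.Dependent.Propositional using (Σ-↔)
open import Data.Sum using (_⊎_; inj₁; inj₂)
open import Data.Sum.Function.Propositional using (_⊎-↔_)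
open import Data.Vec using (Vec; []; _∷_; head; take; drop)
open import Function using (_∘_; _↔_; mk↔ₛ′; Inverse)
open import Function.Properties.Inverse using (↔-refl; ↔-sym; ↔-trans)
open import Relation.Binary.PropositionalEquality using (_≡_; refl; subst)
open import Relation.Nullary using (¬_; Dec; yes; no; contradiction; Irrelevant; does)

private
  variable
    A B : Set
    k l m n : ℕ

-- The value card returns is fixed up to ≡ by A, whichever bijection is supplied.
Finite : Set → Set
Finite A = ∃ λ n → A ↔ Fin n

card : Finite A → ℕ
card = proj₁

finite-↔ : A ↔ B → Finite B → Finite A
finite-↔ A↔B (n , B↔n) = n , ↔-trans A↔B B↔n

finite-¬ : ¬ A → Finite A
finite-¬ ¬a = 0 , mk↔ₛ′ (λ a → contradiction a ¬a) (λ ()) (λ ()) (λ a → contradiction a ¬a)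

finite-Dec : Dec A → Irrelevant A → Finite A
finite-Dec (yes a) irr = 1 , mk↔ₛ′ (λ _ → zero) (λ _ → a) (λ { zero → refl }) (irr a)
finite-Dec (no ¬a) _   = finite-¬ ¬a

finite-⊎ : Finite A → Finite B → Finite (A ⊎ B)
finite-⊎ (a , A↔a) (b , B↔b) = a + b , ↔-trans (A↔a ⊎-↔ B↔b) (↔-sym +↔⊎)

finite-ΣFin : ∀ n {P : Fin n → Set} → (∀ i → Finite (P i)) → Finite (Σ (Fin n) P)
finite-ΣFin zero    fin = finite-¬ λ ()
finite-ΣFin (suc n) fin = finite-↔
  (mk↔ₛ′ (λ { (zero , p) → inj₁ p ; (suc i , p) → inj₂ (i , p) })
         (λ { (inj₁ p) → zero , p ; (inj₂ (i , p)) → suc i , p })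
         (λ { (inj₁ _) → refl ; (inj₂ _) → refl })
         (λ { (zero , _) → refl ; (suc _ , _) → refl }))
  (finite-⊎ (fin zero) (finite-ΣFin n (fin ∘ suc)))

finite-Σ : {P : A → Set} → Finite A → (∀ a → Finite (P a)) → Finite (Σ A P)
finite-Σ (n , A↔n) fin =
  finite-↔ (↔-sym (Σ-↔ (↔-sym A↔n) ↔-refl)) (finite-ΣFin n (fin ∘ Inverse.from A↔n))

finite-Σℕ : ∀ b {P : ℕ → Set} → (∀ k → b ≤ k → ¬ P k) → (∀ k → Finite (P k)) → Finite (Σ ℕ P)
finite-Σℕ zero    empty _   = finite-¬ λ (k , p) → empty k z≤n p
finite-Σℕ (suc b) empty fin = finite-↔
  (mk↔ₛ′ (λ { (zero , p) → inj₁ p ; (suc k , p) → inj₂ (k , p) })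
         (λ { (inj₁ p) → zero , p ; (inj₂ (k , p)) → suc k , p })
         (λ { (inj₁ _) → refl ; (inj₂ _) → refl })
         (λ { (zero , _) → refl ; (suc _ , _) → refl }))
  (finite-⊎ (fin zero) (finite-Σℕ b (λ k b≤k → empty (suc k) (s≤s b≤k)) (fin ∘ suc)))

finite-Vec : Finite A → ∀ n → Finite (Vec A n)
finite-Vec finA zero    = 1 , mk↔ₛ′ (λ _ → zero) (λ _ → []) (λ { zero → refl }) (λ { [] → refl })
finite-Vec finA (suc n) = finite-↔
  (mk↔ₛ′ (λ { (x ∷ xs) → x , xs }) (λ { (x , xs) → x ∷ xs }) (λ { (_ , _) → refl }) (λ { (_ ∷ _) → refl }))
  (finite-Σ finA λ _ → finite-Vec finA n)

-- The chain v₀ < v₁ < ⋯ < v_{m-1} is Fin m with its usual order, v_k being k;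
-- top is v_{m-1}.

top : .{{_ : NonTrivial m}} → Fin m
top {m} = fromℕ< {pred m} (ℕ.≤-reflexive (ℕ.suc-pred m {{nonTrivial⇒nonZero m}}))

infixr 5 _⇒ᴳ_

_⇒ᴳ_ : .{{_ : NonTrivial m}} → Fin m → Fin m → Fin m
p ⇒ᴳ q = if does (p ≤? q) then top else q

-- The leaves of a Bracketing n, read from left to right, are p₁, …, pₙ.
data Bracketing : ℕ → Set where
  var : Bracketing 1
  _⇒_ : Bracketing k → Bracketing l → Bracketing (k + l)

Valuation : ℕ → ℕ → Set
Valuation m n = Vec (Fin m) n

⟦_⟧ : .{{_ : NonTrivial m}} → Bracketing n → Valuation m n → Fin m
⟦ var ⟧           ν = head ν
⟦ _⇒_ {k} φ ψ ⟧ ν = ⟦ φ ⟧ (take k ν) ⇒ᴳ ⟦ ψ ⟧ (drop k ν)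

RootValues : .{{_ : NonTrivial m}} → Fin m → Fin m → Bracketing n → Valuation m n → Set
RootValues i j var           ν = ⊥
RootValues i j (_⇒_ {k} φ ψ) ν = ⟦ φ ⟧ (take k ν) ≡ i × ⟦ ψ ⟧ (drop k ν) ≡ j

EvalPairs : (m : ℕ) .{{_ : NonTrivial m}} → Fin m → ℕ → Set
EvalPairs m k n = Σ (Bracketing n × Valuation m n) λ (t , ν) → ⟦ t ⟧ ν ≡ k

RootPairs : (m : ℕ) .{{_ : NonTrivial m}} → Fin m → Fin m → ℕ → Set
RootPairs m i j n = Σ (Bracketing n × Valuation m n) λ (t , ν) → RootValues i j t ν

Bracketing-size : Bracketing n → 0 < n
Bracketing-size var     = s≤s z≤n
Bracketing-size (φ ⇒ ψ) = ℕ.≤-trans (Bracketing-size φ) (ℕ.m≤m+n _ _)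

Split : ℕ → ℕ → ℕ → Set
Split n k l = Σ (k + l ≡ n) λ _ → Bracketing k × Bracketing l

Bracketing-↔ : Bracketing n ↔ (1 ≡ n ⊎ Σ ℕ λ k → Σ ℕ (Split n k))
Bracketing-↔ = mk↔ₛ′
  (λ { var → inj₁ refl ; (φ ⇒ ψ) → inj₂ (_ , _ , refl , φ , ψ) })
  (λ { (inj₁ refl) → var ; (inj₂ (_ , _ , refl , φ , ψ)) → φ ⇒ ψ })
  (λ { (inj₁ refl) → refl ; (inj₂ (_ , _ , refl , φ , ψ)) → refl })
  (λ { var → refl ; (φ ⇒ ψ) → refl })

finite-Bracketing : ∀ n → Finite (Bracketing n)
finite-Bracketing = <-rec _ step
  where
  module _ (n : ℕ) (rec : ∀ {k} → k < n → Finite (Bracketing k)) where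
    children : ∀ k l → k + l ≡ n → Finite (Bracketing k × Bracketing l)
    children zero    l       _    = finite-¬ λ (φ , _) → contradiction (Bracketing-size φ) λ ()
    children (suc k) zero    _    = finite-¬ λ (_ , ψ) → contradiction (Bracketing-size ψ) λ ()
    children (suc k) (suc l) refl =
      finite-Σ (rec (ℕ.m<m+n (suc k) (s≤s z≤n))) λ _ → rec (ℕ.m<n+m (suc l) (s≤s z≤n))

    split : ∀ k l → Finite (Split n k l)
    split k l with k + l ℕ.≟ n
    ... | yes eq = finite-Σ (finite-Dec (yes eq) ℕ.≡-irrelevant) (children k l)
    ... | no neq = finite-¬ λ (eq , _) → neq eq

    step : Finite (Bracketing n)
    step = finite-↔ Bracketing-↔ (finite-⊎ (finite-Dec (1 ℕ.≟ n) ℕ.≡-irrelevant)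
      (finite-Σℕ (suc n)
        (λ k n<k (l , eq , _) → ℕ.<⇒≱ n<k (subst (k ≤_) eq (ℕ.m≤m+n k l)))
        λ k → finite-Σℕ (suc n)
          (λ l n<l (eq , _) → ℕ.<⇒≱ n<l (subst (l ≤_) eq (ℕ.m≤n+m l k)))
          (split k)))

finite-Instances : ∀ m n → Finite (Bracketing n × Valuation m n)
finite-Instances m n = finite-Σ (finite-Bracketing n) λ _ → finite-Vec (m , ↔-refl) n

finite-≡ : (i j : Fin m) → Finite (i ≡ j)
finite-≡ i j = finite-Dec (i ≟ j) (Decidable⇒UIP.≡-irrelevant _≟_)

finite-RootValues : .{{_ : NonTrivial m}} (i j : Fin m) (t : Bracketing n) (ν : Valuation m n) →
                    Finite (RootValues i j t ν)
finite-RootValues i j var           ν = finite-¬ λ ()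
finite-RootValues i j (_⇒_ {k} φ ψ) ν =
  finite-Σ (finite-≡ (⟦ φ ⟧ (take k ν)) i) λ _ → finite-≡ (⟦ ψ ⟧ (drop k ν)) j

finite-EvalPairs : ∀ m .{{_ : NonTrivial m}} k n → Finite (EvalPairs m k n)
finite-EvalPairs m k n = finite-Σ (finite-Instances m n) λ (t , ν) → finite-≡ (⟦ t ⟧ ν) k

finite-RootPairs : ∀ m .{{_ : NonTrivial m}} i j n → Finite (RootPairs m i j n)
finite-RootPairs m i j n = finite-Σ (finite-Instances m n) λ (t , ν) → finite-RootValues i j t ν

g : (m : ℕ) .{{_ : NonTrivial m}} → Fin m → ℕ → ℕ
g m k n = card (finite-EvalPairs m k n)

-- A single variable has no root split; N₁ is 0 by convention.
N : (m : ℕ) .{{_ : NonTrivial m}} → Fin m → Fin m → ℕ → ℕ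
N m i j 0               = 0
N m i j 1               = 0
N m i j n@(suc (suc _)) = card (finite-RootPairs m i j n)

-- Pair-sequences form a family indexed by (i , j): two of them are identified
-- only if their indices agree, even if their terms coincide.
record PairSequence (m : ℕ) : Set where
  constructor pairSequence
  field
    left right : Fin m

  terms : .{{_ : NonTrivial m}} → ℕ → ℕ
  terms = N m left right

open PairSequence public

ContributesTo : .{{_ : NonTrivial m}} → Fin m → PairSequence m → Set
ContributesTo k s = left s ⇒ᴳ right s ≡ k

-- A power series is its sequence of coefficients, and ⊛ is the Cauchy product.
PowerSeries : Set
PowerSeries = ℕ → ℕ

infix  4 _≈_
infixl 7 _⊛_

_≈_ : PowerSeries → PowerSeries → Set
a ≈ b = ∀ n → a n ≡ b n

_⊛_ : PowerSeries → PowerSeries → PowerSeries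
(a ⊛ b) n = sum (applyUpTo (λ k → a k * b (n ∸ k)) (suc n))

-- Σ_{n≥1} aₙ xⁿ: the value a 0 is discarded.
series : (ℕ → ℕ) → PowerSeries
series a zero    = 0
series a (suc n) = a (suc n)

G : (m : ℕ) .{{_ : NonTrivial m}} → Fin m → PowerSeries
G m k = series (g m k)

{-# OPTIONS --safe #-}

-- Splitting a bracketing at its root, and the valuation with it, identifies the
-- pairs counted by N_n^{i,j} with the pairs of smaller instances, of sizes
-- k + l = n, evaluating to v_i and v_j: this is the Cauchy product.  Its end
-- terms vanish since no bracketing has size 0.  The contributing pair-sequences
-- are counted through the up-sets { i | i ≥ k } of the chain, of size m ∸ k.
module Submission where

open import Defs
open import Axiom.UniquenessOfIdentityProofs using (module Decidable⇒UIP)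
open import Data.Bool using (if_then_else_)
open import Data.Fin using (Fin; zero; suc; toℕ; fromℕ<; _≤_; _>_)
open import Data.Fin.Permutation using (↔⇒≡)
open import Data.Fin.Properties using (*↔×; _≤?_; _≟_; fromℕ<-toℕ; toℕ-fromℕ<; toℕ≤pred[n])
open import Data.List using (applyUpTo)
open import Data.Nat using (ℕ; zero; suc; pred; _+_; _*_; _∸_; _^_; NonTrivial; z≤n; s≤s; nonTrivial⇒n>1)
import Data.Nat as ℕ
open import Data.Nat.DivMod using (_/_; m*n/n≡m)
open import Data.Nat.ListAction using (sum)
import Data.Nat.Properties as ℕ
open import Data.Nat.Tactic.RingSolver using (solve-∀)
open import Data.Product using (Σ; ∃!; _×_; _,_; proj₁; proj₂; uncurry)
open import Data.Product.Function.Dependent.Propositional using (Σ-↔)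
open import Data.Vec using (Vec; []; _∷_; _++_; take; drop)
open import Data.Vec.Properties using (take++drop≡id)
open import Function using (_∘_; _↔_; _⇔_; mk↔ₛ′; mk⇔; Inverse; Equivalence)
open import Function.Properties.Inverse using (↔-refl; ↔-sym; ↔-trans)
open import Function.Related.TypeIsomorphisms using (Σ-assoc)
open import Relation.Binary.PropositionalEquality
  using (_≡_; _≢_; refl; sym; trans; cong; cong₂; subst)
open import Relation.Nullary using (¬_; contradiction; Irrelevant)
open import Relation.Nullary.Decidable using (dec-true; dec-false)

private
  variable
    A B : Set
    k l m n : ℕ

-- A bijection between two `Fin`s forces equal sizes. Hence a count fixed by one enumeration may be
-- computed through another whose size has the wanted shape.
card-unique : (A ↔ B) → (a : Finite A) (b : Finite B) → card a ≡ card b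
card-unique A↔B (_ , A↔a) (_ , B↔b) = ↔⇒≡ (↔-trans (↔-sym A↔a) (↔-trans A↔B B↔b))

resize : k ≡ l → A ↔ Fin k → A ↔ Fin l
resize {A = A} = subst (λ n → A ↔ Fin n)

card-empty : ¬ A → (a : Finite A) → card a ≡ 0
card-empty ¬A a = card-unique ↔-refl a (finite-¬ ¬A)

-- `finite-ΣFin` adds the fibre sizes in index order, by the same recursion as
-- `sum (applyUpTo f n)`.
card-ΣFin : ∀ n (f : ℕ → ℕ) {P : Fin n → Set} (fin : ∀ i → Finite (P i)) →
            (∀ i → card (fin i) ≡ f (toℕ i)) → card (finite-ΣFin n fin) ≡ sum (applyUpTo f n)
card-ΣFin zero    f fin eq = refl
card-ΣFin (suc n) f fin eq =
  cong₂ _+_ (eq zero) (card-ΣFin n (f ∘ suc) (fin ∘ suc) (eq ∘ suc))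

-- Built on `*↔×` so that the size is literally `a * b`, like a term of `⊛`; `finite-Σ` would give a
-- repeated sum.
finite-× : Finite A → Finite B → Finite (A × B)
finite-× (a , A↔a) (b , B↔b) = a * b , ↔-trans (Σ-↔ A↔a B↔b) (↔-sym *↔×)

⇔⇒↔ : Irrelevant A → Irrelevant B → A ⇔ B → A ↔ B
⇔⇒↔ irrA irrB A⇔B = mk↔ₛ′ to from (λ _ → irrB _ _) (λ _ → irrA _ _)
  where open Equivalence A⇔B

Fin-≡-irrelevant : {i j : Fin n} → Irrelevant (i ≡ j)
Fin-≡-irrelevant = Decidable⇒UIP.≡-irrelevant _≟_

take-++ : (μ : Vec A k) (ν : Vec A l) → take k (μ ++ ν) ≡ μ
take-++ []      ν = refl
take-++ (x ∷ μ) ν = cong (x ∷_) (take-++ μ ν)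

drop-++ : (μ : Vec A k) (ν : Vec A l) → drop k (μ ++ ν) ≡ ν
drop-++ []      ν = refl
drop-++ (x ∷ μ) ν = drop-++ μ ν

Vec-+↔× : Vec A (k + l) ↔ (Vec A k × Vec A l)
Vec-+↔× {k = k} = mk↔ₛ′
  (λ ν → take k ν , drop k ν)
  (uncurry _++_)
  (λ (μ , ν) → cong₂ _,_ (take-++ μ ν) (drop-++ μ ν))
  (take++drop≡id k)

Antidiagonal : ℕ → Set
Antidiagonal n = Σ ℕ λ k → Σ ℕ λ l → k + l ≡ n

Antidiagonal-ext : (p q : Antidiagonal n) → proj₁ p ≡ proj₁ q → p ≡ q
Antidiagonal-ext (k , l , p) (_ , l′ , q) refl
  with refl ← ℕ.+-cancelˡ-≡ k l l′ (trans p (sym q)) =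
  cong (λ e → k , l , e) (ℕ.≡-irrelevant p q)

-- Turns the pairs of subtree sizes into the summation index of `⊛`.
Fin↔Antidiagonal : Fin (suc n) ↔ Antidiagonal n
Fin↔Antidiagonal {n} = mk↔ₛ′
  (λ f → toℕ f , n ∸ toℕ f , ℕ.m+[n∸m]≡n (toℕ≤pred[n] f))
  (λ (k , l , eq) → fromℕ< (k< k eq))
  (λ (k , l , eq) → Antidiagonal-ext _ _ (toℕ-fromℕ< (k< k eq)))
  (λ f → fromℕ<-toℕ f _)
  where
  k< : ∀ k {l} → k + l ≡ n → k ℕ.< suc n
  k< k eq = s≤s (ℕ.m+n≤o⇒m≤o k (ℕ.≤-reflexive eq))

module _ (m : ℕ) .{{_ : NonTrivial m}} (i j : Fin m) where

  private
    SplitPairs : ℕ → Set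
    SplitPairs n = Σ (Antidiagonal n) λ (k , l , _) → EvalPairs m i k × EvalPairs m j l

    splitValuation : (φ : Bracketing k) (ψ : Bracketing l) →
      Σ (Valuation m (k + l)) (RootValues i j (φ ⇒ ψ)) ↔
      Σ (Valuation m k × Valuation m l) λ (μ , ν) → ⟦ φ ⟧ μ ≡ i × ⟦ ψ ⟧ ν ≡ j
    -- The fibres agree definitionally: `RootValues` at `φ ⇒ ψ` is stated through the same `take`
    -- and `drop` as `Vec-+↔×`.
    splitValuation φ ψ = Σ-↔ Vec-+↔× ↔-refl

  RootPairs↔SplitPairs : RootPairs m i j n ↔ SplitPairs n
  RootPairs↔SplitPairs = mk↔ₛ′ to from to∘from from∘to
    where
    -- `glue` and `root` carry the fixed subtrees along, so that `cong` reduces both inverse laws to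
    -- those of `splitValuation`.
    glue : (φ : Bracketing k) (ψ : Bracketing l) →
      (Σ (Valuation m k × Valuation m l) λ (μ , ν) → ⟦ φ ⟧ μ ≡ i × ⟦ ψ ⟧ ν ≡ j) → SplitPairs (k + l)
    glue φ ψ ((μ , ν) , p , q) = (_ , _ , refl) , ((φ , μ) , p) , ((ψ , ν) , q)

    root : (φ : Bracketing k) (ψ : Bracketing l) →
      Σ (Valuation m (k + l)) (RootValues i j (φ ⇒ ψ)) → RootPairs m i j (k + l)
    root φ ψ (ν , r) = (φ ⇒ ψ , ν) , r

    to : RootPairs m i j n → SplitPairs n
    -- No `var` clause: there `RootValues` is empty.
    to ((φ ⇒ ψ , ν) , r) = glue φ ψ (Inverse.to (splitValuation φ ψ) (ν , r))

    from : SplitPairs n → RootPairs m i j n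
    from ((_ , _ , refl) , ((φ , μ) , p) , ((ψ , ν) , q)) =
      root φ ψ (Inverse.from (splitValuation φ ψ) ((μ , ν) , p , q))

    to∘from : (s : SplitPairs n) → to (from s) ≡ s
    to∘from ((_ , _ , refl) , ((φ , μ) , p) , ((ψ , ν) , q)) =
      cong (glue φ ψ) (Inverse.strictlyInverseˡ (splitValuation φ ψ) ((μ , ν) , p , q))

    from∘to : (r : RootPairs m i j n) → from (to r) ≡ r
    from∘to ((φ ⇒ ψ , ν) , r) =
      cong (root φ ψ) (Inverse.strictlyInverseʳ (splitValuation φ ψ) (ν , r))

-- The value that `series` discards is 0 anyway, since a bracketing has at least one leaf.
G≗g : ∀ m .{{_ : NonTrivial m}} k n → G m k n ≡ g m k n
G≗g m k zero    = sym (card-empty (λ ((t , _) , _) → contradiction (Bracketing-size t) λ ())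
                                  (finite-EvalPairs m k 0))
G≗g m k (suc n) = refl

-- Root pairs are enumerated by the size `k` of the left subtree; the fibre over `k` is a product of
-- two sets of evaluation pairs.
card-RootPairs : ∀ m .{{_ : NonTrivial m}} i j n →
                 card (finite-RootPairs m i j n) ≡ (G m i ⊛ G m j) n
card-RootPairs m i j n = trans
  (card-unique
    (↔-trans (RootPairs↔SplitPairs m i j) (↔-sym (Σ-↔ Fin↔Antidiagonal ↔-refl)))
    (finite-RootPairs m i j n)
    (finite-ΣFin (suc n) finite-split))
  (card-ΣFin (suc n) (λ k → G m i k * G m j (n ∸ k)) finite-split λ f →
    sym (cong₂ _*_ (G≗g m i (toℕ f)) (G≗g m j (n ∸ toℕ f))))
  where
  finite-split : (f : Fin (suc n)) → Finite (EvalPairs m i (toℕ f) × EvalPairs m j (n ∸ toℕ f))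
  finite-split f = finite-× (finite-EvalPairs m i (toℕ f)) (finite-EvalPairs m j (n ∸ toℕ f))

series-N : ∀ m .{{_ : NonTrivial m}} i j → series (N m i j) ≈ G m i ⊛ G m j
series-N m i j 0             = refl
-- The term `0 * G m j 1` reduces away; what remains is `G m i 1 * 0 + 0`.
series-N m i j 1             = sym (trans (ℕ.+-identityʳ _) (ℕ.*-zeroʳ (G m i 1)))
series-N m i j (suc (suc n)) = card-RootPairs m i j (suc (suc n))

PairSequence↔× : PairSequence m ↔ (Fin m × Fin m)
PairSequence↔× = mk↔ₛ′ (λ s → left s , right s) (uncurry pairSequence) (λ _ → refl) (λ _ → refl)

PairSequence↔Fin : ∀ m → PairSequence m ↔ Fin (m ^ 2)
-- `m ^ 2` unfolds to `m * (m * 1)`.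
PairSequence↔Fin m = resize (cong (m *_) (sym (ℕ.*-identityʳ m)))
  (↔-trans PairSequence↔× (↔-sym *↔×))

-- Removing the least element of the chain lowers the bound by one, following the recursion of `∸`;
-- a bound beyond `n` leaves nothing.
↑↔Fin : ∀ n k → Σ (Fin n) (λ i → k ℕ.≤ toℕ i) ↔ Fin (n ∸ k)
↑↔Fin n       zero    = mk↔ₛ′ proj₁ (λ i → i , z≤n) (λ _ → refl) (λ { (_ , z≤n) → refl })
↑↔Fin zero    (suc k) = mk↔ₛ′ (λ ()) (λ ()) (λ ()) (λ ())
↑↔Fin (suc n) (suc k) = ↔-trans
  (mk↔ₛ′ (λ { (suc i , s≤s p) → i , p }) (λ (i , p) → suc i , s≤s p)
         (λ _ → refl) (λ { (suc i , s≤s p) → refl }))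
  (↑↔Fin n k)

-- The sum is n + (n - 1) + ... + 1, and induction peels off its largest summand. The factor 2
-- stands last so that `m*n/n≡m` cancels it.
triangular : ∀ n → n * (n + 1) ≡ sum (applyUpTo (n ∸_) n) * 2
triangular zero    = refl
triangular (suc n) = trans (step n) (trans (cong (2 * suc n +_) (triangular n)) (regroup n _))
  where
  step : ∀ n → suc n * (suc n + 1) ≡ 2 * suc n + n * (n + 1)
  step = solve-∀
  regroup : ∀ n t → 2 * suc n + t * 2 ≡ (suc n + t) * 2
  regroup = solve-∀

-- Fixing the left index leaves an up-set, so the fibre sizes sum to a triangular number.
≤-pairs↔Fin : ∀ n → Σ (Fin n) (λ i → Σ (Fin n) (i ≤_)) ↔ Fin (n * (n + 1) / 2)
≤-pairs↔Fin n = resize count (proj₂ (finite-ΣFin n finite-↑))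
  where
  finite-↑ : (i : Fin n) → Finite (Σ (Fin n) (i ≤_))
  finite-↑ i = n ∸ toℕ i , ↑↔Fin n (toℕ i)
  count : card (finite-ΣFin n finite-↑) ≡ n * (n + 1) / 2
  count = trans (card-ΣFin n (n ∸_) finite-↑ λ _ → refl)
    (sym (trans (cong (_/ 2) (triangular n)) (m*n/n≡m _ 2)))

module _ {m : ℕ} .{{_ : NonTrivial m}} where

  toℕ-top : toℕ (top {m}) ≡ pred m
  toℕ-top = toℕ-fromℕ< _

  ≤top : (i : Fin m) → i ≤ top {m}
  ≤top i = subst (toℕ i ℕ.≤_) (sym toℕ-top) (toℕ≤pred[n] i)

  ⇒ᴳ-≤ : (i j : Fin m) → i ≤ j → i ⇒ᴳ j ≡ top
  ⇒ᴳ-≤ i j i≤j = cong (if_then top else j) (dec-true (i ≤? j) i≤j)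

  ⇒ᴳ-> : (i j : Fin m) → i > j → i ⇒ᴳ j ≡ j
  ⇒ᴳ-> i j i>j = cong (if_then top else j) (dec-false (i ≤? j) (ℕ.<⇒≱ i>j))

  -- If i > j, the output is j; were it the top, i would exceed the top.
  contributesTo-top : (s : PairSequence m) → ContributesTo top s ⇔ left s ≤ right s
  contributesTo-top (pairSequence i j) = mk⇔
    (λ eq → ℕ.≮⇒≥ λ i>j → ℕ.<⇒≱ i>j
      (subst (i ≤_) (trans (sym eq) (⇒ᴳ-> i j i>j)) (≤top i)))
    (⇒ᴳ-≤ i j)

  -- An output below the top excludes i ≤ j, and for i > j the output is j itself.
  contributesTo-≢top : (k : Fin m) → k ≢ top → (s : PairSequence m) →
                       ContributesTo k s ⇔ (right s ≡ k × left s > k)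
  contributesTo-≢top k k≢top (pairSequence i j) = mk⇔
    (λ eq →
      let i>j = ℕ.≰⇒> λ i≤j → k≢top (trans (sym eq) (⇒ᴳ-≤ i j i≤j))
          j≡k = trans (sym (⇒ᴳ-> i j i>j)) eq
      in j≡k , subst (i >_) j≡k i>j)
    (λ { (refl , i>k) → ⇒ᴳ-> i k i>k })

  topContributors↔Fin : Σ (PairSequence m) (ContributesTo top) ↔ Fin (m * (m + 1) / 2)
  topContributors↔Fin = ↔-trans
    -- Both conditions are propositions, so their equivalence is a bijection of fibres.
    (Σ-↔ PairSequence↔× λ {s} → ⇔⇒↔ Fin-≡-irrelevant ℕ.≤-irrelevant (contributesTo-top s))
    (↔-trans Σ-assoc (≤-pairs↔Fin m))

  contributors↔Fin : (k : Fin m) → k ≢ top →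
                     Σ (PairSequence m) (ContributesTo k) ↔ Fin (m ∸ 1 ∸ toℕ k)
  contributors↔Fin k k≢top = resize (sym (ℕ.∸-+-assoc m 1 (toℕ k)))
    (↔-trans (Σ-↔ ↔-refl λ {s} → ⇔⇒↔ Fin-≡-irrelevant irr (contributesTo-≢top k k≢top s))
    -- The right index is fixed at `k`, and i > k unfolds to membership in the up-set of
    -- `suc (toℕ k)`.
    (↔-trans forgetRight (↑↔Fin m (suc (toℕ k)))))
    where
    irr : ∀ {s : PairSequence m} → Irrelevant (right s ≡ k × left s > k)
    irr (p , q) (p′ , q′) = cong₂ _,_ (Fin-≡-irrelevant p p′) (ℕ.≤-irrelevant q q′)

    forgetRight : Σ (PairSequence m) (λ s → right s ≡ k × left s > k) ↔ Σ (Fin m) (_> k)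
    forgetRight = mk↔ₛ′
      (λ (s , _ , p) → left s , p) (λ (i , p) → pairSequence i k , refl , p)
      (λ _ → refl) (λ { (_ , refl , _) → refl })

  -- The top has index m - 1, and m ≥ 2 makes `m ∸ 2` strictly smaller despite truncation.
  ≤m∸2⇒≢top : (j : Fin m) → toℕ j ℕ.≤ m ∸ 2 → j ≢ top
  ≤m∸2⇒≢top j j≤ refl = ℕ.<⇒≱ (ℕ.∸-monoʳ-< (ℕ.n<1+n 1) (nonTrivial⇒n>1 m))
    (subst (ℕ._≤ m ∸ 2) toℕ-top j≤)

theorem9 : (m : ℕ) .{{_ : NonTrivial m}} →
    ( (PairSequence m ↔ Fin (m ^ 2))
      × (∀ (i j : Fin m) → ∃! _≡_ λ (s : PairSequence m) →
          left s ≡ i × right s ≡ j × (∀ n → terms s n ≡ N m i j n)) )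
    × ( (∀ (i j : Fin m) → series (N m i j) ≈ G m i ⊛ G m j)
        × (∀ (i j : Fin m) → N m i j 1 ≡ 0) )
    × ( (∀ (i j : Fin m) → (i ≤ j → i ⇒ᴳ j ≡ top) × (i > j → i ⇒ᴳ j ≡ j))
        × ( (∀ (s : PairSequence m) → ContributesTo top s ⇔ left s ≤ right s)
            × (Σ (PairSequence m) (ContributesTo top) ↔ Fin (m * (m + 1) / 2)) )
        × (∀ (j : Fin m) → toℕ j ℕ.≤ m ∸ 2 →
            (∀ (s : PairSequence m) → ContributesTo j s ⇔ (right s ≡ j × left s > j))
            × (Σ (PairSequence m) (ContributesTo j) ↔ Fin (m ∸ 1 ∸ toℕ j))) )
theorem9 m =
    (PairSequence↔Fin m , λ i j →
      -- The two indices determine the record, whence uniqueness.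
      pairSequence i j , (refl , refl , λ _ → refl) , λ { (refl , refl , _) → refl })
  , (series-N m , λ _ _ → refl)
  , (λ i j → ⇒ᴳ-≤ i j , ⇒ᴳ-> i j)
  , (contributesTo-top , topContributors↔Fin)
  , λ j j≤ → let j≢top = ≤m∸2⇒≢top j j≤ in contributesTo-≢top j j≢top , contributors↔Fin j j≢top
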